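{- Let $G=(V,E)$ be a finite undirected graph and let $T\subseteq V$. Then the set $J_{\rm vertex}(G,T)\subseteq\mathbb{Z}^T$ of vertex-feasible vectors and the set $J_{\rm edge}(G,T)\subseteq\mathbb{Z}^T$ of edge-feasible vectors are both jump systems.
   Context: A $T$-path is a path $P$ in $G$ such that $V(P)\cap T$ consists exactly of the two (distinct) endpoints of $P$. Two $T$-paths $P,Q$ are openly disjoint if $V(P)\cap V(Q)\subseteq T$, and edge-disjoint if $E(P)\cap E(Q)=\emptyset$. A vector $m\in\mathbb{Z}^T$ is vertex-feasible (resp. edge-feasible) if there exists a set of pairwise openly disjoint (resp. pairwise edge-disjoint) $T$-paths such that each $t\in T$ is the endpoint of exactly $m(t)$ of these paths. $J_{\rm vertex}(G,T)$ and $J_{\rm edge}(G,T)$ denote the sets of all vertex-feasible, resp. edge-feasible, vectors. For $s\in T$, $e_s\in\{0,1\}^T$ is the unit vector with $e_s(s)=1$ and $e_s(t)=0$ for $t\neq s$. For $x,y\in\mathbb{Z}^T$, a step from $x$ to $y$ is: $x$ itself if $x=y$; or $x+e_s$ for some $s\in T$ with $x_s<y_s$; or $x-e_s$ for some $s\in T$ with $x_s>y_s$. A set $J\subseteq\mathbb{Z}^T$ is a jump system if for every $x,y\in J$ and every step $x'$ from $x$ to $y$, either $x'\in J$ or there is a step $x''$ from $x'$ to $y$ with $x''\in J$. -}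

module Defs where

open import Data.Nat using (ℕ)
open import Data.Integer using (ℤ; +_; _+_; _-_; _<_; _>_)
open import Data.Fin using (Fin; _≟_)
open import Data.Bool using (if_then_else_)
open import Data.Product using (_×_; _,_; Σ; ∃; ∃-syntax)
open import Data.Sum using (_⊎_)
open import Data.List using (List; []; _∷_; reverse)
open import Data.List.Membership.Propositional using (_∈_)
open import Data.List.Relation.Unary.Unique.Propositional using (Unique)
open import Data.List.Relation.Unary.AllPairs using (AllPairs)
open import Data.Empty using (⊥)
open import Relation.Nullary using (¬_; does)
open import Relation.Binary.PropositionalEquality using (_≡_)

-- Finite undirected (multi)graphs on vertex set Fin n.
-- Edges are Fin m; each edge has an (unordered) pair of endpoints.

record Graph (n : ℕ) : Set where
  field
    m    : ℕ
    ends : Fin m → Fin n × Fin n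

module _ {n : ℕ} (G : Graph n) where
  open Graph G

  Joins : Fin m → Fin n → Fin n → Set
  Joins e u v = (ends e ≡ (u , v)) ⊎ (ends e ≡ (v , u))

  data Walk : Fin n → Fin n → Set where
    []   : ∀ {v} → Walk v v
    step : ∀ {u v w} (e : Fin m) → Joins e u v → Walk v w → Walk u w

  verts : ∀ {u w} → Walk u w → List (Fin n)
  verts {u} []           = u ∷ []
  verts {u} (step e _ p) = u ∷ verts p

  edges : ∀ {u w} → Walk u w → List (Fin m)
  edges []           = []
  edges (step e _ p) = e ∷ edges p

  IsPath : ∀ {u w} → Walk u w → Set
  IsPath p = Unique (verts p)

  module _ {k : ℕ} (τ : Fin k → Fin n) where
    -- T is the image of the (injective) map τ; Z^T is Fin k → ℤ.
    InT : Fin n → Set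
    InT v = ∃[ i ] τ i ≡ v

    record TPath : Set where
      field
        src tgt : Fin k
        distinct : ¬ (src ≡ tgt)
        walk     : Walk (τ src) (τ tgt)
        isPath   : IsPath walk
        onlyEnds : ∀ v → v ∈ verts walk → InT v → (v ≡ τ src) ⊎ (v ≡ τ tgt)
    open TPath public

    SamePath : TPath → TPath → Set
    SamePath P Q =
      (verts (walk P) ≡ verts (walk Q) × edges (walk P) ≡ edges (walk Q)) ⊎
      (verts (walk P) ≡ reverse (verts (walk Q)) × edges (walk P) ≡ reverse (edges (walk Q)))

    OpenlyDisjoint : TPath → TPath → Set
    OpenlyDisjoint P Q = ∀ v → v ∈ verts (walk P) → v ∈ verts (walk Q) → InT v

    EdgeDisjoint : TPath → TPath → Set
    EdgeDisjoint P Q = ∀ e → e ∈ edges (walk P) → e ∈ edges (walk Q) → ⊥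

    endCount : List TPath → Fin k → ℕ
    endCount []       t = 0
    endCount (P ∷ ps) t =
      (if does (src P ≟ t) then 1 else 0) Data.Nat.+
      ((if does (tgt P ≟ t) then 1 else 0) Data.Nat.+ endCount ps t)

    -- m is feasible w.r.t. a disjointness relation R: there is a set
    -- (list of pairwise distinct paths) of pairwise R-disjoint T-paths
    -- such that each t is the endpoint of exactly m(t) of them.
    Feasible : (TPath → TPath → Set) → (Fin k → ℤ) → Set
    Feasible R mv = Σ (List TPath) λ ps →
      AllPairs (λ P Q → ¬ SamePath P Q × R P Q) ps ×
      (∀ t → mv t ≡ + endCount ps t)

    Jvertex : (Fin k → ℤ) → Set
    Jvertex = Feasible OpenlyDisjoint

    Jedge : (Fin k → ℤ) → Set
    Jedge = Feasible EdgeDisjoint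

unitVec : ∀ {k} → Fin k → Fin k → ℤ
unitVec s t = if does (s ≟ t) then + 1 else + 0

Step : ∀ {k} → (Fin k → ℤ) → (Fin k → ℤ) → (Fin k → ℤ) → Set
Step {k} x y x' =
  ((∀ t → x t ≡ y t) × (∀ t → x' t ≡ x t)) ⊎
  (∃[ s ] (x s < y s × (∀ t → x' t ≡ x t + unitVec s t))) ⊎
  (∃[ s ] (x s > y s × (∀ t → x' t ≡ x t - unitVec s t)))

IsJumpSystem : ∀ {k} → ((Fin k → ℤ) → Set) → Set
IsJumpSystem J = ∀ x y → J x → J y → ∀ x' → Step x y x' →
  J x' ⊎ (∃[ x'' ] (Step x' y x'' × J x''))

{-# OPTIONS --safe #-}
module Submission where

-- Both disjointness notions become plain disjointness of the interiors of paths in an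
-- auxiliary graph with node set T ⊎ A: A consists of the edges of G, adjacent when they
-- share a vertex outside T (edge case), or of the edges and vertices of G with the
-- incidence relation at the vertices outside T (vertex case).
--
-- There, let S and Q be systems of disjoint paths, Q realizing y, such that S misses a
-- target vector w by one end at s (count S + e_s = w). Unless w_s > y_s, in which case S
-- realizes a step from w to y, some path q of Q leaves s along a link not used by S at s. If q avoids
-- S, add it: its other end t gives a step up, or else t has surplus ends and some S-path
-- leaving t along a link foreign to Q can be removed. If q first meets S at v on a path
-- i … v … j, replace that path by s … v … j. Choosing the orientation with j ≠ s and
-- i ≠ tgt q, the piece i … v contains a link not in Q. Each time S again misses w by one
-- end, and the number of links of S not in Q has dropped.

open import Defs
open import Data.Nat using (ℕ; zero; suc; _+_; _∸_; _≤_; _<_; z≤n; s≤s; _<?_)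
open import Data.Nat.Properties hiding (_≟_; _<?_)
open import Data.Nat.ListAction using (sum)
open import Data.Nat.ListAction.Properties using (sum-↭)
open import Data.Nat.Tactic.RingSolver using (solve-∀)
open import Data.Integer as ℤ using (ℤ; +<+) renaming (+_ to pos)
import Data.Integer.Properties as ℤₚ
open import Data.Fin using (Fin; _≟_)
import Data.Fin.Properties as Finₚ
open import Data.Bool using (if_then_else_)
open import Data.Empty using (⊥; ⊥-elim)
open import Data.Product using (_×_; _,_; ∃; ∃-syntax; ∃₂; proj₁; proj₂) renaming (swap to ×-swap)
open import Data.Product.Properties using (,-injectiveˡ) renaming (≡-dec to ×-≡-dec)
open import Data.Sum using (_⊎_; inj₁; inj₂; swap; [_,_]′)
open import Data.Sum.Properties using (inj₁-injective) renaming (≡-dec to ⊎-≡-dec)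
open import Data.List using (List; []; _∷_; _++_; [_]; reverse; map; concatMap)
open import Data.List.Properties using (unfold-reverse; ++-assoc)
open import Data.List.Membership.Propositional using (_∈_; _∉_; find; lose)
open import Data.List.Membership.Propositional.Properties using (∈-∃++; ∈-++⁺ˡ; ∈-++⁺ʳ; ∈-++⁻; ∈-concatMap⁻; ∈-concatMap⁺)
open import Data.List.Relation.Unary.Any using (Any; here; there; any?)
open import Data.List.Relation.Unary.Any.Properties using (reverse⁺; reverse⁻)
open import Data.List.Relation.Unary.All as All using (All; []; _∷_)
open import Data.List.Relation.Unary.All.Properties using (¬Any⇒All¬; All¬⇒¬Any)
open import Data.List.Relation.Unary.AllPairs as AllPairs using (AllPairs; []; _∷_)
import Data.List.Relation.Unary.AllPairs.Properties as AllPairsₚ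
open import Data.List.Relation.Unary.Unique.Propositional using (Unique)
open import Data.List.Relation.Unary.Unique.Propositional.Properties using (Unique[x∷xs]⇒x∉xs) renaming (++⁺ to Unique-++⁺)
open import Data.List.Relation.Binary.Disjoint.Propositional using (Disjoint)
open import Data.List.Relation.Binary.Permutation.Propositional using (_↭_; ↭-sym; ↭⇒↭ₛ)
import Data.List.Relation.Binary.Permutation.Setoid.Properties as Permₛ
open import Data.List.Relation.Binary.Permutation.Propositional.Properties using (shift; map⁺; ↭-reverse; ∈-resp-↭)
open import Function using (_∘_)
open import Function.Definitions using (Injective)
open import Relation.Binary using (DecidableEquality; Symmetric)
open import Relation.Binary.PropositionalEquality hiding ([_])
open import Relation.Nullary using (¬_; Dec; yes; no; does; contradiction)
open import Relation.Nullary.Decidable using (_⊎-dec_; decidable-stable)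

-- Permutations, repetition-free lists and a weighted pigeonhole principle.

private variable
  B : Set

AllPairs-resp-↭ : {R : B → B → Set} → Symmetric R → ∀ {xs ys} → xs ↭ ys → AllPairs R xs → AllPairs R ys
AllPairs-resp-↭ {R = R} sy p = Permₛ.AllPairs-resp-↭ (setoid _) sy (resp₂ R) (↭⇒↭ₛ p)

∈⇒↭ : ∀ {x : B} {xs} → x ∈ xs → ∃[ ys ] xs ↭ x ∷ ys
∈⇒↭ {x = x} x∈ with ys , zs , refl ← ∈-∃++ x∈ = ys ++ zs , shift x ys zs

Unique-++⁻ : ∀ (xs : List B) {ys} → Unique (xs ++ ys) → Unique xs × Unique ys × Disjoint xs ys
Unique-++⁻ []       u        = [] , u , λ ()
Unique-++⁻ (x ∷ xs) (x∉ ∷ u) with ux , uy , d ← Unique-++⁻ xs u =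
  All.tabulate (λ m → All.lookup x∉ (∈-++⁺ˡ m)) ∷ ux , uy ,
  λ { (here refl , m) → All.lookup x∉ (∈-++⁺ʳ xs m) refl ; (there m , m′) → d (m , m′) }

Unique-reverse : ∀ {xs : List B} → Unique xs → Unique (reverse xs)
Unique-reverse {xs = xs} = AllPairs-resp-↭ (λ x≢y → x≢y ∘ sym) (↭-sym (↭-reverse xs))

pigeonhole : DecidableEquality B → (f : B → ℕ) → ∀ {xs} → Unique xs → ∀ ys →
  sum (map f ys) < sum (map f xs) → ∃[ x ] (x ∈ xs × x ∉ ys × 0 < f x)
pigeonhole _≟B_ f {x ∷ xs} (x∉ ∷ u) ys lt with any? (x ≟B_) ys
... | yes x∈ys with ys′ , ys↭ ← ∈⇒↭ x∈ys
  with z , z∈ , z∉ , f>0 ← pigeonhole _≟B_ f u ys′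
         (+-cancelˡ-< (f x) _ _ (subst (_< _) (sum-↭ (map⁺ f ys↭)) lt)) =
  z , there z∈ , z∉ys , f>0
  where
  z∉ys : z ∉ ys
  z∉ys z∈ys with ∈-resp-↭ ys↭ z∈ys
  ... | here refl = All.lookup x∉ z∈ refl
  ... | there m   = z∉ m
pigeonhole _≟B_ f {x ∷ xs} (x∉ ∷ u) ys lt | no x∉ys with f x in eq
... | suc _ = x , here refl , x∉ys , subst (0 <_) (sym eq) (s≤s z≤n)
... | zero with z , z∈ , rest ← pigeonhole _≟B_ f u ys lt = z , there z∈ , rest

-- Unit vectors over the natural numbers.

δ : ∀ {k} → Fin k → Fin k → ℕ
δ s t = if does (s ≟ t) then 1 else 0

δ-diag : ∀ {k} (s : Fin k) → δ s s ≡ 1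
δ-diag s with s ≟ s
... | yes _ = refl
... | no ¬p = contradiction refl ¬p

δ-pos : ∀ {k} {s t : Fin k} → 0 < δ s t → s ≡ t
δ-pos {s = s} {t} f>0 with s ≟ t
... | yes eq = eq
... | no _   = contradiction f>0 λ ()

unitVec-δ : ∀ {k} (s t : Fin k) → unitVec s t ≡ pos (δ s t)
unitVec-δ s t with s ≟ t
... | yes _ = refl
... | no _  = refl

pos-+-cancel : ∀ a d → pos (a + d) ℤ.- pos d ≡ pos a
pos-+-cancel a d = begin
  pos (a + d) ℤ.- pos d        ≡⟨ ℤₚ.+-assoc (pos a) (pos d) (ℤ.- pos d) ⟩
  pos a ℤ.+ (pos d ℤ.- pos d)    ≡⟨ cong (ℤ._+_ (pos a)) (ℤₚ.+-inverseʳ (pos d)) ⟩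
  pos a ℤ.+ pos 0              ≡⟨ ℤₚ.+-identityʳ (pos a) ⟩
  pos a                      ∎
  where open ≡-Reasoning

-- Makes the truncated subtraction of a unit vector exact when a downward step is taken.
δ-≤ : ∀ {k} {s : Fin k} {f : Fin k → ℕ} → 0 < f s → ∀ t → δ s t ≤ f t
δ-≤ {s = s} f>0 t with s ≟ t
... | yes refl = f>0
... | no _     = z≤n

-- Chains and paths in the auxiliary graph.

module Exchange {k : ℕ} {A : Set} (_≟A_ : DecidableEquality A)
  (R : Fin k ⊎ A → Fin k ⊎ A → Set) (R-sym : Symmetric R)
  (R-terminals : ∀ {i j} → ¬ R (inj₁ i) (inj₁ j)) where

  X : Set
  X = Fin k ⊎ A

  _≟X_ : DecidableEquality X
  _≟X_ = ⊎-≡-dec _≟_ _≟A_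

  -- Only members of `A` can stand between the two ends, so by typing no path has a terminal in its
  -- interior, and disjointness is a matter of the lists alone.
  data Chain : X → List A → X → Set where
    end : ∀ {x y} → R x y → Chain x [] y
    _∷_ : ∀ {x y a l} → R x (inj₂ a) → Chain (inj₂ a) l y → Chain x (a ∷ l) y

  chain-split : ∀ {x y} l {a l′} → Chain x (l ++ a ∷ l′) y → Chain x l (inj₂ a) × Chain (inj₂ a) l′ y
  chain-split []      (r ∷ c) = end r , c
  chain-split (_ ∷ l) (r ∷ c) with c₁ , c₂ ← chain-split l c = r ∷ c₁ , c₂

  chain-join : ∀ {x y l a l′} → Chain x l (inj₂ a) → Chain (inj₂ a) l′ y → Chain x (l ++ a ∷ l′) y
  chain-join (end r) c′ = r ∷ c′
  chain-join (r ∷ c) c′ = r ∷ chain-join c c′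

  chain-reverse : ∀ {x y l} → Chain x l y → Chain y (reverse l) x
  chain-reverse (end r) = end (R-sym r)
  chain-reverse (_∷_ {a = a} {l} r c) =
    subst (λ z → Chain _ z _) (sym (unfold-reverse a l)) (chain-join (chain-reverse c) (end (R-sym r)))

  -- The node that follows the source of a chain with interior `l` and target `y`; the default `y`
  -- serves the chain of a single link. `lastN` is the mirror image.
  headN : List A → X → X
  headN []      y = y
  headN (a ∷ _) y = inj₂ a

  lastN : X → List A → X
  lastN x []      = x
  lastN x (a ∷ l) = lastN (inj₂ a) l

  headN-++ : ∀ l {a l′ y} → headN (l ++ a ∷ l′) y ≡ headN l (inj₂ a)
  headN-++ []      = refl
  headN-++ (_ ∷ _) = refl

  lastN-++ : ∀ {x} l {a l′} → lastN x (l ++ a ∷ l′) ≡ lastN (inj₂ a) l′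
  lastN-++ []      = refl
  lastN-++ (b ∷ l) = lastN-++ l

  headN-reverse : ∀ l {y} → headN (reverse l) y ≡ lastN y l
  headN-reverse []      = refl
  headN-reverse (a ∷ l) = trans (cong (λ z → headN z _) (unfold-reverse a l))
    (trans (headN-++ (reverse l)) (headN-reverse l))

  headN-∈ : ∀ {l y a} → y ≢ inj₂ a → headN l y ≡ inj₂ a → a ∈ l
  headN-∈ {[]}    ne eq   = contradiction eq ne
  headN-∈ {_ ∷ _} ne refl = here refl

  lastN-cases : ∀ x l → (l ≡ [] × lastN x l ≡ x) ⊎ (∃[ a ] (a ∈ l × lastN x l ≡ inj₂ a))
  lastN-cases x []      = inj₁ (refl , refl)
  lastN-cases x (a ∷ l) with lastN-cases (inj₂ a) l
  ... | inj₁ (refl , eq)   = inj₂ (a , here refl , eq)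
  ... | inj₂ (b , b∈ , eq) = inj₂ (b , there b∈ , eq)

  record Path : Set where
    field
      src tgt  : Fin k
      inner    : List A
      distinct : src ≢ tgt
      chain    : Chain (inj₁ src) inner (inj₁ tgt)
      unique   : Unique inner
  open Path

  flip : Path → Path
  flip p = record
    { src = tgt p ; tgt = src p ; inner = reverse (inner p)
    ; distinct = distinct p ∘ sym ; chain = chain-reverse (chain p)
    ; unique = Unique-reverse (unique p) }

  -- Paths are meant to be undirected, but a `Path` has a source and a target. This relation lets
  -- each argument choose the direction that suits it.
  data Orientation (p : Path) : Path → Set where
    forward  : Orientation p p
    backward : Orientation p (flip p)

  inner⁺ : ∀ {p p′ a} → Orientation p p′ → a ∈ inner p → a ∈ inner p′
  inner⁺ forward  m = m
  inner⁺ backward m = reverse⁺ m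

  inner⁻ : ∀ {p p′ a} → Orientation p p′ → a ∈ inner p′ → a ∈ inner p
  inner⁻ forward  m = m
  inner⁻ backward m = reverse⁻ m

  -- Disjoint systems and their end counts.

  Disj : Path → Path → Set
  Disj p q = ∀ a → a ∈ inner p → a ∈ inner q → ⊥

  Disj-sym : Symmetric Disj
  Disj-sym d a m m′ = d a m′ m

  System : List Path → Set
  System = AllPairs Disj

  count₁ : Fin k → Path → ℕ
  count₁ t p = δ (src p) t + δ (tgt p) t

  count : List Path → Fin k → ℕ
  count S t = sum (map (count₁ t) S)

  count₁-orient : ∀ {p p′} t → Orientation p p′ → count₁ t p ≡ count₁ t p′
  count₁-orient t forward  = refl
  count₁-orient {p} t backward = +-comm (δ (src p) t) _

  -- This makes it meaningful to speak of the path of a system through a given node.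
  owner-unique : ∀ {S p q a} → System S → p ∈ S → q ∈ S → a ∈ inner p → a ∈ inner q → p ≡ q
  owner-unique (d ∷ ds) (here refl) (here refl) _ _  = refl
  owner-unique (d ∷ ds) (here refl) (there q∈) m m′  = ⊥-elim (All.lookup d q∈ _ m m′)
  owner-unique (d ∷ ds) (there p∈)  (here refl) m m′ = ⊥-elim (All.lookup d p∈ _ m′ m)
  owner-unique (d ∷ ds) (there p∈)  (there q∈) m m′  = owner-unique ds p∈ q∈ m m′

  -- Ports: the ends of paths, told apart by their first links.

  Port : Set
  Port = Fin k × X

  _≟P_ : DecidableEquality Port
  _≟P_ = ×-≡-dec _≟_ _≟X_

  -- A terminal may be the end of many paths. Recording the neighbouring node as well separates
  -- these ends, so that they can be counted as elements of a list without repetitions.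
  srcPort tgtPort : Path → Port
  srcPort p = src p , headN (inner p) (inj₁ (tgt p))
  tgtPort p = tgt p , lastN (inj₁ (src p)) (inner p)

  ports₁ : Path → List Port
  ports₁ p = srcPort p ∷ tgtPort p ∷ []

  ports : List Path → List Port
  ports = concatMap ports₁

  ports-count : ∀ S t → sum (map (λ x → δ (proj₁ x) t) (ports S)) ≡ count S t
  ports-count []      t = refl
  ports-count (p ∷ S) t = trans (cong (λ z → δ (src p) t + (δ (tgt p) t + z)) (ports-count S t))
    (sym (+-assoc (δ (src p) t) _ _))

  srcPort-flip : ∀ p → srcPort (flip p) ≡ tgtPort p
  srcPort-flip p = cong (tgt p ,_) (headN-reverse (inner p))

  srcPort-∈ : ∀ {p p′} → Orientation p p′ → srcPort p′ ∈ ports₁ p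
  srcPort-∈ forward      = here refl
  srcPort-∈ {p} backward = there (here (srcPort-flip p))

  port-orient : ∀ {p x} → x ∈ ports₁ p → ∃[ p′ ] (Orientation p p′ × srcPort p′ ≡ x)
  port-orient         (here refl)         = _ , forward , refl
  port-orient {p = p} (there (here refl)) = _ , backward , srcPort-flip p

  lastN-inner : ∀ p → ∃[ a ] (a ∈ inner p × lastN (inj₁ (src p)) (inner p) ≡ inj₂ a)
  lastN-inner p with lastN-cases (inj₁ (src p)) (inner p) | chain p
  ... | inj₂ h          | _ = h
  ... | inj₁ (eq , _)   | c with end r ← subst (λ l → Chain _ l _) eq c = contradiction r R-terminals

  -- `R-terminals` excludes an empty interior, so the second component of a port is always an
  -- interior node. This is why disjoint paths cannot share a port.
  port-inner : ∀ {p x} → x ∈ ports₁ p → ∃[ a ] (a ∈ inner p × proj₂ x ≡ inj₂ a)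
  port-inner {p} (here refl) with inner p | chain p
  ... | []    | end r = contradiction r R-terminals
  ... | a ∷ _ | _     = a , here refl , refl
  port-inner {p} (there (here refl)) = lastN-inner p

  -- The two ports of one path differ in their terminals, those of two disjoint paths in their
  -- interior nodes.
  ports-unique : ∀ {S} → System S → Unique (ports S)
  ports-unique []               = []
  ports-unique (_∷_ {p} {S} d ds) = Unique-++⁺
    (((λ eq → distinct p (,-injectiveˡ eq)) ∷ []) ∷ [] ∷ []) (ports-unique ds) disj
    where
    disj : Disjoint (ports₁ p) (ports S)
    disj (m , m′) with q , q∈ , mq ← find (∈-concatMap⁻ ports₁ {xs = S} m′)
      with a , a∈ , eq ← port-inner {p} m | b , b∈ , eq′ ← port-inner {q} mq
      with refl ← trans (sym eq) eq′ = All.lookup d q∈ a a∈ b∈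

  -- An end of a path is identified by its port, so a surplus of ends at t yields an unshared port there.
  surplus-port : ∀ {S} → System S → ∀ S′ t → count S′ t < count S t →
    ∃₂ λ p p′ → p ∈ S × Orientation p p′ × src p′ ≡ t × srcPort p′ ∉ ports S′
  surplus-port {S} dS S′ t lt
    with x , x∈ , x∉ , f>0 ← pigeonhole _≟P_ (λ x → δ (proj₁ x) t) (ports-unique dS) (ports S′)
           (subst₂ _<_ (sym (ports-count S′ t)) (sym (ports-count S t)) lt)
    with p , p∈ , m ← find (∈-concatMap⁻ ports₁ {xs = S} x∈)
    with p′ , o , refl ← port-orient {p} m
    = p , p′ , p∈ , o , δ-pos f>0 , x∉

  -- Links of a path and the neighbours of its nodes.

  links : X → List A → X → List (X × X)
  links x []      y = (x , y) ∷ []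
  links x (a ∷ l) y = (x , inj₂ a) ∷ links (inj₂ a) l y

  Linked : Path → X → X → Set
  Linked p u v = (u , v) ∈ ls ⊎ (v , u) ∈ ls
    where ls = links (inj₁ (src p)) (inner p) (inj₁ (tgt p))

  links-++⁺ : ∀ {x y z} l {a l′} → z ∈ links x l (inj₂ a) ⊎ z ∈ links (inj₂ a) l′ y → z ∈ links x (l ++ a ∷ l′) y
  links-++⁺ []      (inj₁ (here eq)) = here eq
  links-++⁺ []      (inj₂ m)         = there m
  links-++⁺ (_ ∷ l) (inj₁ (here eq)) = here eq
  links-++⁺ (_ ∷ l) (inj₁ (there m)) = there (links-++⁺ l (inj₁ m))
  links-++⁺ (_ ∷ l) (inj₂ m)         = there (links-++⁺ l (inj₂ m))

  links-reverse : ∀ {x y u v} l → (u , v) ∈ links x l y → (v , u) ∈ links y (reverse l) x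
  links-reverse [] (here refl) = here refl
  links-reverse {x} {y} {u} {v} (a ∷ l) m = subst (λ z → (v , u) ∈ links y z x) (sym (unfold-reverse a l))
    (links-++⁺ (reverse l) (flipped m))
    where
    flipped : (u , v) ∈ links x (a ∷ l) y → (v , u) ∈ links y (reverse l) (inj₂ a) ⊎ (v , u) ∈ links (inj₂ a) [] x
    flipped (here refl) = inj₂ (here refl)
    flipped (there m′)  = inj₁ (links-reverse l m′)

  Linked-orient : ∀ {p p′ u v} → Orientation p p′ → Linked p u v → Linked p′ u v
  Linked-orient forward      h        = h
  Linked-orient {p} backward (inj₁ m) = inj₂ (links-reverse (inner p) m)
  Linked-orient {p} backward (inj₂ m) = inj₁ (links-reverse (inner p) m)

  link-source : ∀ {x y u v} l → (u , v) ∈ links x l y → u ≡ x ⊎ ∃[ a ] (a ∈ l × u ≡ inj₂ a)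
  link-source []      (here refl) = inj₁ refl
  link-source (_ ∷ l) (here refl) = inj₁ refl
  link-source (a ∷ l) (there m) with link-source l m
  ... | inj₁ eq            = inj₂ (a , here refl , eq)
  ... | inj₂ (b , b∈ , eq) = inj₂ (b , there b∈ , eq)

  link-target : ∀ {x y u v} l → (u , v) ∈ links x l y → v ≡ y ⊎ ∃[ a ] (a ∈ l × v ≡ inj₂ a)
  link-target []      (here refl) = inj₁ refl
  link-target (a ∷ l) (here refl) = inj₂ (a , here refl , refl)
  link-target (a ∷ l) (there m) with link-target l m
  ... | inj₁ eq            = inj₁ eq
  ... | inj₂ (b , b∈ , eq) = inj₂ (b , there b∈ , eq)

  -- As `v` occurs only once in the interior and is not the start, exactly one link leaves it in the
  -- forward direction: the one at the displayed position.
  link-next : ∀ {x y u v} l {l′} → x ≢ inj₂ v → Unique (l ++ v ∷ l′) →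
    (inj₂ v , u) ∈ links x (l ++ v ∷ l′) y → u ≡ headN l′ y
  link-next []      ne uq (here refl) = contradiction refl ne
  link-next [] {[]}    ne uq (there (here refl)) = refl
  link-next [] {_ ∷ _} ne uq (there (here refl)) = refl
  link-next [] {b ∷ l′} ne uq (there (there m)) with link-source l′ m
  ... | inj₁ refl            = contradiction (here refl) (Unique[x∷xs]⇒x∉xs uq)
  ... | inj₂ (_ , a∈ , refl) = contradiction (there a∈) (Unique[x∷xs]⇒x∉xs uq)
  link-next (_ ∷ l) ne uq (here refl) = contradiction refl ne
  link-next (b ∷ l) ne (b∉ ∷ uq) (there m) =
    link-next l (λ { refl → All.lookup b∉ (∈-++⁺ʳ l (here refl)) refl }) uq m

  link-previous : ∀ {x y u v} l {l′} → y ≢ inj₂ v → Unique (l ++ v ∷ l′) →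
    (u , inj₂ v) ∈ links x (l ++ v ∷ l′) y → u ≡ lastN x l
  link-previous []      ne uq (here refl) = refl
  link-previous [] {l′} ne uq (there m) with link-target l′ m
  ... | inj₁ eq              = contradiction (sym eq) ne
  ... | inj₂ (_ , a∈ , refl) = contradiction a∈ (Unique[x∷xs]⇒x∉xs uq)
  link-previous (b ∷ l) ne (b∉ ∷ uq) (here refl) = contradiction refl (All.lookup b∉ (∈-++⁺ʳ l (here refl)))
  link-previous (b ∷ l) ne (b∉ ∷ uq) (there m)   = link-previous l ne uq m

  link-terminalˡ : ∀ {x y u t} l → (inj₁ t , u) ∈ links x l y → inj₁ t ≡ x × u ≡ headN l y
  link-terminalˡ []      (here refl) = refl , refl
  link-terminalˡ (_ ∷ l) (here refl) = refl , refl
  link-terminalˡ (_ ∷ l) (there m) with () ← proj₁ (link-terminalˡ l m)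

  link-terminalʳ : ∀ {x y u t} l → (u , inj₁ t) ∈ links x l y → inj₁ t ≡ y × u ≡ lastN x l
  link-terminalʳ []      (here refl) = refl , refl
  link-terminalʳ (_ ∷ l) (there m)   = link-terminalʳ l m

  Linked-port : ∀ p {t u} → Linked p (inj₁ t) u → (t , u) ∈ ports₁ p
  Linked-port p (inj₁ m) with refl , refl ← link-terminalˡ (inner p) m = here refl
  Linked-port p (inj₂ m) with refl , refl ← link-terminalʳ (inner p) m = there (here refl)

  Linked-inner : ∀ p {v u} → Linked p (inj₂ v) u → v ∈ inner p
  Linked-inner p (inj₁ m) with link-source (inner p) m
  ... | inj₂ (_ , v∈ , refl) = v∈
  Linked-inner p (inj₂ m) with link-target (inner p) m
  ... | inj₂ (_ , v∈ , refl) = v∈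

  -- An interior node has degree two in its path: a link is read either away from `v`, giving the
  -- successor, or towards `v`, giving the predecessor.
  Linked-neighbour : ∀ p {v u} l {l′} → inner p ≡ l ++ v ∷ l′ → Linked p (inj₂ v) u →
    u ≡ lastN (inj₁ (src p)) l ⊎ u ≡ headN l′ (inj₁ (tgt p))
  Linked-neighbour p {v} l {l′} eq (inj₁ m) = inj₂ (link-next l (λ ()) (subst Unique eq (unique p))
    (subst (λ z → _ ∈ links _ z _) eq m))
  Linked-neighbour p {v} l {l′} eq (inj₂ m) = inj₁ (link-previous l (λ ()) (subst Unique eq (unique p))
    (subst (λ z → _ ∈ links _ z _) eq m))

  -- The cost of a system relative to a fixed system `Q`.

  module Towards (Q : List Path) (dQ : System Q) where

    LinkedQ : X → X → Set
    LinkedQ u v = Any (λ q → Linked q u v) Q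

    linkedQ? : ∀ u v → Dec (LinkedQ u v)
    linkedQ? u v = any? (λ q → any? (≟L (u , v)) _ ⊎-dec any? (≟L (v , u)) _) Q
      where ≟L = ×-≡-dec _≟X_ _≟X_

    -- Summed along paths, this counts the links foreign to `Q`, the quantity that decreases in the
    -- exchange.
    linkCost : X → X → ℕ
    linkCost u v = if does (linkedQ? u v) then 0 else 1

    linkCost≡0 : ∀ {u v} → LinkedQ u v → linkCost u v ≡ 0
    linkCost≡0 {u} {v} h with linkedQ? u v
    ... | yes _ = refl
    ... | no ¬h = contradiction h ¬h

    linkCost≡0⁻ : ∀ {u v} → linkCost u v ≡ 0 → LinkedQ u v
    linkCost≡0⁻ {u} {v} eq with linkedQ? u v
    ... | yes h = h

    linkedQ-sym : ∀ {u v} → LinkedQ u v → LinkedQ v u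
    linkedQ-sym h with q , q∈ , l ← find h = lose q∈ (swap l)

    linkCost-sym : ∀ u v → linkCost u v ≡ linkCost v u
    linkCost-sym u v with linkedQ? u v
    ... | yes h = sym (linkCost≡0 (linkedQ-sym h))
    ... | no ¬h with linkedQ? v u
    ...   | yes h = contradiction (linkedQ-sym h) ¬h
    ...   | no _  = refl

    chainCost : X → List A → X → ℕ
    chainCost x []      y = linkCost x y
    chainCost x (a ∷ l) y = linkCost x (inj₂ a) + chainCost (inj₂ a) l y

    chainCost-++ : ∀ {x y} l {a l′} → chainCost x (l ++ a ∷ l′) y ≡ chainCost x l (inj₂ a) + chainCost (inj₂ a) l′ y
    chainCost-++ []      = refl
    chainCost-++ (b ∷ l) = trans (cong (_ +_) (chainCost-++ l)) (sym (+-assoc (linkCost _ _) _ _))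

    chainCost-reverse : ∀ {x y} l → chainCost y (reverse l) x ≡ chainCost x l y
    chainCost-reverse {x} {y} [] = linkCost-sym y x
    chainCost-reverse {x} {y} (a ∷ l) = begin
      chainCost y (reverse (a ∷ l)) x                          ≡⟨ cong (λ z → chainCost y z x) (unfold-reverse a l) ⟩
      chainCost y (reverse l ++ [ a ]) x                       ≡⟨ chainCost-++ (reverse l) ⟩
      chainCost y (reverse l) (inj₂ a) + linkCost (inj₂ a) x   ≡⟨ cong₂ _+_ (chainCost-reverse l) (linkCost-sym _ x) ⟩
      chainCost (inj₂ a) l y + linkCost x (inj₂ a)             ≡⟨ +-comm _ (linkCost x (inj₂ a)) ⟩
      linkCost x (inj₂ a) + chainCost (inj₂ a) l y             ∎
      where open ≡-Reasoning

    chainCost≡0 : ∀ {x y} l → (∀ {u v} → (u , v) ∈ links x l y → LinkedQ u v) → chainCost x l y ≡ 0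
    chainCost≡0 []      h = linkCost≡0 (h (here refl))
    chainCost≡0 (a ∷ l) h = cong₂ _+_ (linkCost≡0 (h (here refl))) (chainCost≡0 l (h ∘ there))

    cost₁ : Path → ℕ
    cost₁ p = chainCost (inj₁ (src p)) (inner p) (inj₁ (tgt p))

    cost : List Path → ℕ
    cost S = sum (map cost₁ S)

    cost₁-orient : ∀ {p p′} → Orientation p p′ → cost₁ p ≡ cost₁ p′
    cost₁-orient forward      = refl
    cost₁-orient {p} backward = sym (chainCost-reverse (inner p))

    cost₁-Q : ∀ {q q′} → q ∈ Q → Orientation q q′ → cost₁ q′ ≡ 0
    cost₁-Q {q} q∈ o = trans (sym (cost₁-orient o)) (chainCost≡0 (inner q) (λ m → lose q∈ (inj₁ m)))

    -- Were the first link of `p` on a path of `Q`, it would be an end link there, since terminals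
    -- are never interior, and so would give a port of `Q`.
    cost₁-foreign-port : ∀ p → srcPort p ∉ ports Q → 0 < cost₁ p
    cost₁-foreign-port p x∉ = ≤-trans (n≢0⇒n>0 first≢0) (first≤ (inner p))
      where
      first≤ : ∀ {x y} l → linkCost x (headN l y) ≤ chainCost x l y
      first≤ []      = ≤-refl
      first≤ (_ ∷ _) = m≤m+n _ _
      first≢0 : linkCost (inj₁ (src p)) (headN (inner p) (inj₁ (tgt p))) ≢ 0
      first≢0 eq with q , q∈ , l ← find (linkCost≡0⁻ eq) =
        x∉ (∈-concatMap⁺ ports₁ (lose q∈ (Linked-port q l)))

    -- A link of cost zero at `v` lies on some path of `Q`. As the paths of `Q` are disjoint, that
    -- path is the one already known to pass through `v`, where only two neighbours are available.
    neighbour : ∀ {q q′ v u} → q ∈ Q → Orientation q q′ → ∀ l {l′} → inner q′ ≡ l ++ v ∷ l′ →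
      linkCost (inj₂ v) u ≡ 0 → u ≡ lastN (inj₁ (src q′)) l ⊎ u ≡ headN l′ (inj₁ (tgt q′))
    neighbour {q} {q′} q∈ o l eq free with q₀ , q₀∈ , link ← find (linkCost≡0⁻ free)
      with refl ← owner-unique dQ q₀∈ q∈ (Linked-inner q₀ link)
             (inner⁻ o (subst (_ ∈_) (sym eq) (∈-++⁺ʳ l (here refl))))
      = Linked-neighbour q′ l eq (Linked-orient o link)

    -- A chain that leaves v along links of Q, without turning back, must follow the Q-path through v to its end.
    free-chain-end : ∀ {q q′ v i} → q ∈ Q → Orientation q q′ → ∀ r l {l′} → inner q′ ≡ l ++ v ∷ l′ →
      chainCost (inj₂ v) r (inj₁ i) ≡ 0 → Unique (v ∷ r) →
      headN r (inj₁ i) ≢ lastN (inj₁ (src q′)) l → i ≡ tgt q′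
    free-chain-end q∈ o [] l {l′} eq free uq ne with neighbour q∈ o l eq free
    ... | inj₁ back = contradiction back ne
    ... | inj₂ next with l′
    ...   | [] = inj₁-injective next
    free-chain-end {v = v} q∈ o (u ∷ r) l {l′} eq free (v∉ ∷ uq) ne
      with neighbour q∈ o l eq (m+n≡0⇒m≡0 _ free)
    ... | inj₁ back = contradiction back ne
    ... | inj₂ next with l′
    ...   | w ∷ l″ with refl ← next = free-chain-end q∈ o r (l ++ [ v ])
      (trans eq (sym (++-assoc l [ v ] _))) (m+n≡0⇒n≡0 (linkCost (inj₂ v) (inj₂ u)) free) uq
      (λ h → All.lookup v∉ (there (headN-∈ (λ ()) (trans h (lastN-++ l)))) refl)

    -- First meeting points, choice of direction, and removal of a path.

    Hit : List Path → A → Set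
    Hit S a = Any (λ p → a ∈ inner p) S

    hit? : ∀ S a → Dec (Hit S a)
    hit? S a = any? (λ p → any? (a ≟A_) (inner p)) S

    first-hit : ∀ S l → All (¬_ ∘ Hit S) l ⊎
      (∃[ l₁ ] ∃[ v ] ∃[ l₂ ] (l ≡ l₁ ++ v ∷ l₂ × All (¬_ ∘ Hit S) l₁ × Hit S v))
    first-hit S []      = inj₁ []
    first-hit S (a ∷ l) with hit? S a | first-hit S l
    ... | yes h | _        = inj₂ ([] , a , l , refl , [] , h)
    ... | no ¬h | inj₁ ¬hs = inj₁ (¬h ∷ ¬hs)
    ... | no ¬h | inj₂ (l₁ , v , l₂ , refl , ¬hs , h) = inj₂ (a ∷ l₁ , v , l₂ , refl , ¬h ∷ ¬hs , h)

    -- Used with the ends `s` and `t` of the path of `Q`: `tgt p′ ≢ s` gives the rerouted path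
    -- distinct ends, and `src p′ ≢ t` forces the abandoned piece to leave `Q`. If `s` is an end of
    -- `p`, start there; otherwise start at an end different from `t`.
    choose-orientation : ∀ p {s t} → s ≢ t → ∃[ p′ ] (Orientation p p′ × src p′ ≢ t × tgt p′ ≢ s)
    choose-orientation p {s} {t} s≢t with src p ≟ s | tgt p ≟ s | src p ≟ t
    ... | yes refl | _        | _        = p , forward , s≢t , distinct p ∘ sym
    ... | no s₁    | yes refl | _        = flip p , backward , s≢t , s₁
    ... | no _     | no t₁    | no s₂    = p , forward , s₂ , t₁
    ... | no s₁    | no _     | yes refl = flip p , backward , distinct p ∘ sym , s₁

    -- Here `p′` is an oriented copy of a member of `S`, so that the removed path may be taken to
    -- run in the direction chosen for it.
    record Extraction (S : List Path) (p′ : Path) : Set where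
      field
        rest     : List Path
        system   : System (p′ ∷ rest)
        rest⊆    : ∀ {p} → p ∈ rest → p ∈ S
        count-eq : ∀ t → count S t ≡ count₁ t p′ + count rest t
        cost-eq  : cost S ≡ cost₁ p′ + cost rest
    open Extraction

    extract : ∀ {S p p′} → System S → p ∈ S → Orientation p p′ → Extraction S p′
    extract {S} {p} dS p∈ o with S′ , S↭ ← ∈⇒↭ p∈ with d ∷ ds ← AllPairs-resp-↭ (λ {p} {q} → Disj-sym {p} {q}) S↭ dS = record
      { rest     = S′
      ; system   = All.map (λ f a m → f a (inner⁻ o m)) d ∷ ds
      ; rest⊆    = λ m → ∈-resp-↭ (↭-sym S↭) (there m)
      ; count-eq = λ t → trans (sum-↭ (map⁺ (count₁ t) S↭)) (cong (_+ count S′ t) (count₁-orient t o))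
      ; cost-eq  = trans (sum-↭ (map⁺ cost₁ S↭)) (cong (_+ cost S′) (cost₁-orient o)) }

    -- The exchange recursion.

    data Reached (w : Fin k → ℕ) : Set where
      -- The two constructors are the unit steps from `w` towards the count vector of `Q`, written
      -- with additions only so that they stay within the natural numbers.
      up   : ∀ S → System S → ∀ r → w r < count Q r → (∀ t → count S t ≡ w t + δ r t) → Reached w
      down : ∀ S → System S → ∀ r → count Q r < w r → (∀ t → count S t + δ r t ≡ w t) → Reached w

    -- The vector `w` stays fixed while `S` and the missing end `s` change from call to call. Each
    -- round through `relax-add` or `relax-reroute` lowers `cost S`; `fuel` exceeds this cost and
    -- makes the recursion structural.
    relax : ∀ fuel S → System S → cost S < fuel → ∀ s w → (∀ t → count S t + δ s t ≡ w t) → Reached w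
    relax-add : ∀ fuel S → System S → cost S < suc fuel → ∀ q w → cost₁ q ≡ 0 → All (¬_ ∘ Hit S) (inner q) →
      (∀ t → count S t + δ (src q) t ≡ w t) → Reached w
    relax-reroute : ∀ fuel S → System S → cost S < suc fuel → ∀ {q q′ l₁ v l₂ p} w → q ∈ Q → Orientation q q′ →
      srcPort q′ ∉ ports S → inner q′ ≡ l₁ ++ v ∷ l₂ → All (¬_ ∘ Hit S) l₁ → p ∈ S → v ∈ inner p →
      (∀ t → count S t + δ (src q′) t ≡ w t) → Reached w

    relax (suc fuel) S dS c< s w eq with count Q s <? w s
    ... | yes lt = down S dS s lt eq
    -- Here `count S s + 1 ≡ w s ≤ count Q s`, so `Q` has more ends at `s` than `S` has.
    ... | no ≮ with q , q′ , q∈ , o , refl , x∉ ← surplus-port dQ S s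
                 (≤-trans (≤-reflexive (trans (+-comm 1 _) (trans (cong (count S s +_) (sym (δ-diag s))) (eq s)))) (≮⇒≥ ≮))
      with first-hit S (inner q′)
    ... | inj₁ miss = relax-add fuel S dS c< q′ w (cost₁-Q q∈ o) miss eq
    ... | inj₂ (l₁ , v , l₂ , split , miss , hit) with p , p∈ , v∈ ← find hit =
      relax-reroute fuel S dS c< w q∈ o x∉ split miss p∈ v∈ eq

    relax-add fuel S dS c< q w free miss eq = go (w (tgt q) <? count Q (tgt q))
      where
      dq : System (q ∷ S)
      dq = All.tabulate (λ p∈ a m m′ → All.lookup miss m (lose p∈ m′)) ∷ dS
      count-add : ∀ t → count (q ∷ S) t ≡ w t + δ (tgt q) t
      count-add t = trans (rearrange (δ (src q) t) _ _) (cong (_+ δ (tgt q) t) (eq t))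
        where
        rearrange : ∀ a b c → a + b + c ≡ c + a + b
        rearrange = solve-∀
      go : Dec (w (tgt q) < count Q (tgt q)) → Reached w
      go (yes lt) = up (q ∷ S) dq (tgt q) lt count-add
      -- With `q` added, the count at `tgt q` is `w (tgt q) + 1`, which exceeds that of `Q`.
      go (no ≮) with p , p′ , p∈ , o , src≡ , x∉ ← surplus-port dq Q (tgt q)
                   (≤-trans (s≤s (≮⇒≥ ≮)) (≤-reflexive (trans (+-comm 1 _)
                     (trans (cong (w (tgt q) +_) (sym (δ-diag (tgt q)))) (sym (count-add (tgt q)))))))
        = relax fuel (rest e) (AllPairs.tail (system e)) (≤-trans cost-drop (≤-pred c<)) (tgt p′) w count-rest
        where
        e = extract dq p∈ o
        -- Adding `q` costs nothing, while the removed path has positive cost through its foreign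
        -- first link.
        cost-drop : cost (rest e) < cost S
        cost-drop = begin-strict
          cost (rest e)             <⟨ +-monoˡ-≤ (cost (rest e)) (cost₁-foreign-port p′ x∉) ⟩
          cost₁ p′ + cost (rest e)  ≡⟨ cost-eq e ⟨
          cost₁ q + cost S          ≡⟨ cong (_+ cost S) free ⟩
          cost S                    ∎
          where open ≤-Reasoning
        -- Removing `p′` cancels the extra end at `tgt q` and leaves an end missing at `tgt p′`.
        count-rest : ∀ t → count (rest e) t + δ (tgt p′) t ≡ w t
        count-rest t = +-cancelˡ-≡ (δ (tgt q) t) _ _ (begin
          δ (tgt q) t + (count (rest e) t + δ (tgt p′) t)  ≡⟨ cong (λ z → δ z t + (count (rest e) t + δ (tgt p′) t)) src≡ ⟨
          δ (src p′) t + (count (rest e) t + δ (tgt p′) t) ≡⟨ rearrange (δ (src p′) t) _ _ ⟩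
          count₁ t p′ + count (rest e) t                   ≡⟨ count-eq e t ⟨
          count (q ∷ S) t                                  ≡⟨ count-add t ⟩
          w t + δ (tgt q) t                                ≡⟨ +-comm (w t) _ ⟩
          δ (tgt q) t + w t                                ∎)
          where
          open ≡-Reasoning
          rearrange : ∀ a b c → a + (b + c) ≡ a + c + b
          rearrange = solve-∀

    relax-reroute fuel S dS c< {q} {q′} {l₁} {v} {l₂} {p} w q∈ o x∉ split miss p∈ v∈ eq
      with p′ , o′ , src≢ , tgt≢ ← choose-orientation p (distinct q′)
      with p₁ , p₂ , split′ ← ∈-∃++ (inner⁺ o′ v∈)
      = relax fuel (new ∷ rest e) (disjoint-new ∷ AllPairs.tail (system e))
          (≤-trans cost-drop (≤-pred c<)) (src p′) w count-new
      where
      e = extract dS p∈ o′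
      uniqueQ = Unique-++⁻ l₁ (subst Unique split (unique q′))
      uniqueP = Unique-++⁻ p₁ (subst Unique split′ (unique p′))
      p₂⊆ : ∀ {a} → a ∈ v ∷ p₂ → a ∈ inner p′
      p₂⊆ m = subst (_ ∈_) (sym split′) (∈-++⁺ʳ p₁ m)
      new : Path
      new = record
        { src = src q′ ; tgt = tgt p′ ; inner = l₁ ++ v ∷ p₂ ; distinct = tgt≢ ∘ sym
        ; chain = chain-join
            (proj₁ (chain-split l₁ (subst (λ l → Chain _ l _) split (chain q′))))
            (proj₂ (chain-split p₁ (subst (λ l → Chain _ l _) split′ (chain p′))))
        -- `l₁` comes before the first hit, so it avoids `p` and hence the part of `p` that is kept.
        ; unique = Unique-++⁺ (proj₁ uniqueQ) (proj₁ (proj₂ uniqueP))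
            λ (m , m′) → All.lookup miss m (lose p∈ (inner⁻ o′ (p₂⊆ m′))) }
      disjoint-new : All (Disj new) (rest e)
      disjoint-new = All.tabulate λ r∈ a m m′ → [
        (λ m₁ → All.lookup miss m₁ (lose (rest⊆ e r∈) m′)) ,
        (λ m₂ → All.lookup (AllPairs.head (system e)) r∈ a (p₂⊆ m₂) m′) ]′ (∈-++⁻ l₁ m)
      -- The new path supplies the end missing at `src q′`, and the end of `p′` at its source is now
      -- the missing one.
      count-new : ∀ t → count (new ∷ rest e) t + δ (src p′) t ≡ w t
      count-new t = begin
        δ (src q′) t + δ (tgt p′) t + count (rest e) t + δ (src p′) t ≡⟨ rearrange (δ (src q′) t) _ _ _ ⟩
        count₁ t p′ + count (rest e) t + δ (src q′) t                 ≡⟨ cong (_+ δ (src q′) t) (count-eq e t) ⟨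
        count S t + δ (src q′) t                                      ≡⟨ eq t ⟩
        w t                                                           ∎
        where
        open ≡-Reasoning
        rearrange : ∀ a b c d → a + b + c + d ≡ d + b + c + a
        rearrange = solve-∀
      -- `p′` and `q′` arrive at `v` from different nodes. A common node in `A` would be a hit
      -- before `v`; a common terminal would make the first link of `q′` a port of `S`.
      turn : headN (reverse p₁) (inj₁ (src p′)) ≢ lastN (inj₁ (src q′)) l₁
      turn h = meet (trans (sym (headN-reverse p₁)) h)
        where
        meet : lastN (inj₁ (src p′)) p₁ ≢ lastN (inj₁ (src q′)) l₁
        meet h′ with lastN-cases (inj₁ (src p′)) p₁ | lastN-cases (inj₁ (src q′)) l₁
        ... | inj₁ (refl , e₁) | inj₁ (refl , e₂) = x∉ (∈-concatMap⁺ ports₁ (lose p∈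
              (subst (_∈ ports₁ p) same-port (srcPort-∈ o′))))
          where
          same-port : srcPort p′ ≡ srcPort q′
          same-port = cong₂ _,_ (inj₁-injective h′)
            (trans (cong (λ l → headN l _) split′) (sym (cong (λ l → headN l _) split)))
        ... | inj₁ (_ , e₁)      | inj₂ (_ , _ , e₂)  = contradiction (trans (sym e₁) (trans h′ e₂)) λ ()
        ... | inj₂ (_ , _ , e₁)  | inj₁ (_ , e₂)      = contradiction (trans (sym e₁) (trans h′ e₂)) λ ()
        ... | inj₂ (a , a∈ , e₁) | inj₂ (b , b∈ , e₂) with refl ← trans (sym e₁) (trans h′ e₂) =
          All.lookup miss b∈ (lose p∈ (inner⁻ o′ (subst (_ ∈_) (sym split′) (∈-++⁺ˡ a∈))))
      -- If every link of this piece were in `Q`, then reading it backwards from `v` would follow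
      -- `q′` away from where it came, up to `tgt q′`, which the orientation has excluded as the
      -- source of `p′`.
      abandoned : chainCost (inj₁ (src p′)) p₁ (inj₂ v) ≢ 0
      abandoned zero-cost = src≢ (free-chain-end q∈ o (reverse p₁) l₁ split
        (trans (chainCost-reverse p₁) zero-cost)
        (¬Any⇒All¬ _ (λ m → proj₂ (proj₂ uniqueP) (reverse⁻ m , here refl)) ∷ Unique-reverse (proj₁ uniqueP))
        turn)
      adopted : chainCost (inj₁ (src q′)) l₁ (inj₂ v) ≡ 0
      adopted = m+n≡0⇒m≡0 _ (trans (sym (chainCost-++ l₁))
        (trans (cong (λ l → chainCost _ l _) (sym split)) (cost₁-Q q∈ o)))
      kept : ℕ
      kept = chainCost (inj₂ v) p₂ (inj₁ (tgt p′))
      -- The piece beyond `v` is kept, and the costly piece before it gives way to a section of a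
      -- path of `Q`, which is free.
      cost-drop : cost (new ∷ rest e) < cost S
      cost-drop = begin-strict
        cost₁ new + cost (rest e)                             ≡⟨ cong (_+ cost (rest e)) (chainCost-++ l₁) ⟩
        chainCost (inj₁ _) l₁ _ + kept + cost (rest e)        ≡⟨ cong (λ z → z + kept + cost (rest e)) adopted ⟩
        kept + cost (rest e)                                  <⟨ +-monoˡ-< (cost (rest e)) (+-monoˡ-≤ kept (n≢0⇒n>0 abandoned)) ⟩
        chainCost (inj₁ (src p′)) p₁ _ + kept + cost (rest e) ≡⟨ cong (_+ cost (rest e)) (chainCost-++ p₁) ⟨
        chainCost _ (p₁ ++ v ∷ p₂) _ + cost (rest e)          ≡⟨ cong (λ l → chainCost _ l _ + cost (rest e)) split′ ⟨
        cost₁ p′ + cost (rest e)                              ≡⟨ cost-eq e ⟨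
        cost S                                                ∎
        where open ≤-Reasoning

    -- A downward step at `s` offers no missing end to begin with. Removing a path that ends at `s`
    -- creates one: relative to `w`, only its other end is missing.
    lower : ∀ S → System S → ∀ s w → count Q s < count S s → (∀ t → w t + δ s t ≡ count S t) → Reached w
    lower S dS s w lt eq with p , p′ , p∈ , o , refl , _ ← surplus-port dS Q s lt =
      relax _ (rest e) (AllPairs.tail (system e)) ≤-refl (tgt p′) w λ t → +-cancelʳ-≡ (δ (src p′) t) _ _ (begin
        count (rest e) t + δ (tgt p′) t + δ (src p′) t  ≡⟨ rearrange (count (rest e) t) _ _ ⟩
        count₁ t p′ + count (rest e) t                  ≡⟨ count-eq e t ⟨
        count S t                                       ≡⟨ eq t ⟨
        w t + δ (src p′) t                              ∎)
      where
      e = extract dS p∈ o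
      open ≡-Reasoning
      rearrange : ∀ a b c → a + b + c ≡ c + b + a
      rearrange = solve-∀

  -- The jump property for disjoint systems in the auxiliary graph.

  Realizable : (Fin k → ℤ) → Set
  Realizable x = ∃[ S ] (System S × (∀ t → x t ≡ pos (count S t)))

  realizable-jump : IsJumpSystem Realizable
  realizable-jump x y (S , dS , xS) (Q , dQ , yQ) x′ = λ where
      (inj₁ (_ , x′≡x)) → inj₁ (S , dS , λ t → trans (x′≡x t) (xS t))
      -- `≤-refl` sets the fuel to `suc (cost S)`, and `w` is by definition the count of `S` with
      -- one end added at `s`.
      (inj₂ (inj₁ (s , _ , x′≡))) → inj₂ (conclude (relax _ S dS ≤-refl s _ (λ _ → refl))
        (λ t → trans (x′≡ t) (cong₂ ℤ._+_ (xS t) (unitVec-δ s t))))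
      (inj₂ (inj₂ (s , x>y , x′≡))) →
        let lt  = ℤₚ.drop‿+<+ (subst₂ ℤ._<_ (yQ s) (xS s) x>y)
            dec = λ t → m∸n+n≡m (δ-≤ {f = count S} (≤-trans (s≤s z≤n) lt) t)
        in inj₂ (conclude (lower S dS s (λ t → count S t ∸ δ s t) lt dec) (λ t → begin
          x′ t                                    ≡⟨ x′≡ t ⟩
          x t ℤ.- unitVec s t                     ≡⟨ cong₂ ℤ._-_ (trans (xS t) (cong pos (sym (dec t)))) (unitVec-δ s t) ⟩
          pos (count S t ∸ δ s t + δ s t) ℤ.- pos (δ s t) ≡⟨ pos-+-cancel _ (δ s t) ⟩
          pos (count S t ∸ δ s t)                   ∎))
    where
    open Towards Q dQ
    open ≡-Reasoning
    conclude : ∀ {w} → Reached w → (∀ t → x′ t ≡ pos (w t)) → ∃[ x″ ] (Step x′ y x″ × Realizable x″)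
    conclude {w} (up S′ dS′ r lt eq) x′w = (λ t → pos (count S′ t)) ,
      inj₂ (inj₁ (r , subst₂ ℤ._<_ (sym (x′w r)) (sym (yQ r)) (+<+ lt) ,
        λ t → trans (cong pos (eq t)) (sym (cong₂ ℤ._+_ (x′w t) (unitVec-δ r t))))) ,
      S′ , dS′ , λ _ → refl
    conclude {w} (down S′ dS′ r lt eq) x′w = (λ t → pos (count S′ t)) ,
      inj₂ (inj₂ (r , subst₂ ℤ._<_ (sym (yQ r)) (sym (x′w r)) (+<+ lt) ,
        λ t → sym (trans (cong₂ ℤ._-_ (trans (x′w t) (cong pos (sym (eq t)))) (unitVec-δ r t))
          (pos-+-cancel _ (δ r t))))) ,
      S′ , dS′ , λ _ → refl

-- Incidence, walks and loop erasure in `G`.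

module _ {n : ℕ} (G : Graph n) where
  open Graph G

  Inc : Fin m → Fin n → Set
  Inc e v = proj₁ (ends e) ≡ v ⊎ proj₂ (ends e) ≡ v

  joins-incˡ : ∀ {e u v} → Joins G e u v → Inc e u
  joins-incˡ (inj₁ eq) = inj₁ (cong proj₁ eq)
  joins-incˡ (inj₂ eq) = inj₂ (cong proj₂ eq)

  joins-incʳ : ∀ {e u v} → Joins G e u v → Inc e v
  joins-incʳ (inj₁ eq) = inj₂ (cong proj₂ eq)
  joins-incʳ (inj₂ eq) = inj₁ (cong proj₁ eq)

  joins-inc⁻ : ∀ {e u v x} → Joins G e u v → Inc e x → x ≡ u ⊎ x ≡ v
  joins-inc⁻ (inj₁ eq) (inj₁ i) = inj₁ (trans (sym i) (cong proj₁ eq))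
  joins-inc⁻ (inj₁ eq) (inj₂ i) = inj₂ (trans (sym i) (cong proj₂ eq))
  joins-inc⁻ (inj₂ eq) (inj₁ i) = inj₂ (trans (sym i) (cong proj₁ eq))
  joins-inc⁻ (inj₂ eq) (inj₂ i) = inj₁ (trans (sym i) (cong proj₂ eq))

  inc-joins : ∀ {e u v} → Inc e u → Inc e v → u ≢ v → Joins G e u v
  inc-joins (inj₁ p) (inj₁ q) u≢v = contradiction (trans (sym p) q) u≢v
  inc-joins (inj₁ p) (inj₂ q) _   = inj₁ (cong₂ _,_ p q)
  inc-joins (inj₂ p) (inj₁ q) _   = inj₂ (cong₂ _,_ q p)
  inc-joins (inj₂ p) (inj₂ q) u≢v = contradiction (trans (sym p) q) u≢v

  source∈ : ∀ {u w} (p : Walk G u w) → u ∈ verts G p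
  source∈ []           = here refl
  source∈ (step _ _ _) = here refl

  target∈ : ∀ {u w} (p : Walk G u w) → w ∈ verts G p
  target∈ []           = here refl
  target∈ (step _ _ p) = there (target∈ p)

  edge-end∈ : ∀ {u w e x} (p : Walk G u w) → e ∈ edges G p → Inc e x → x ∈ verts G p
  edge-end∈ (step _ J p) (here refl) i with joins-inc⁻ J i
  ... | inj₁ refl = here refl
  ... | inj₂ refl = there (source∈ p)
  edge-end∈ (step _ J p) (there m) i = there (edge-end∈ p m i)

  -- A second use of an edge would bring the walk back to the vertex at which the edge was first
  -- entered.
  edges-unique : ∀ {u w} (p : Walk G u w) → IsPath G p → Unique (edges G p)
  edges-unique []           _        = []
  edges-unique (step e J p) (u∉ ∷ uq) =
    ¬Any⇒All¬ _ (λ m → All¬⇒¬Any u∉ (edge-end∈ p m (joins-incˡ J))) ∷ edges-unique p uq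

  -- Containment of vertices and edges is what carries disjointness and the condition on terminals
  -- over to the shortened walk.
  record Refinement {u v w} (p : Walk G u w) (q : Walk G v w) : Set where
    field
      isPath′ : IsPath G q
      verts⊆  : ∀ {x} → x ∈ verts G q → x ∈ verts G p
      edges⊆  : ∀ {e} → e ∈ edges G q → e ∈ edges G p
  open Refinement public

  suffix : ∀ {u v w} (p : Walk G v w) → IsPath G p → u ∈ verts G p → ∃ (Refinement {u = v} {u} {w} p)
  suffix []             uq       (here refl) = [] , record { isPath′ = uq ; verts⊆ = λ m → m ; edges⊆ = λ m → m }
  suffix p@(step _ _ _) uq       (here refl) = p , record { isPath′ = uq ; verts⊆ = λ m → m ; edges⊆ = λ m → m }
  suffix (step _ _ p)   (_ ∷ uq) (there m) with q , r ← suffix p uq m =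
    q , record { isPath′ = isPath′ r ; verts⊆ = there ∘ verts⊆ r ; edges⊆ = there ∘ edges⊆ r }

  -- If `u` reappears in the already erased tail, the loop is cut by continuing from that
  -- reappearance.
  loop-erase : ∀ {u w} (p : Walk G u w) → ∃ (Refinement {u = u} {u} {w} p)
  loop-erase [] = [] , record { isPath′ = [] ∷ [] ; verts⊆ = λ m → m ; edges⊆ = λ m → m }
  loop-erase {u} (step e J p) with q , r ← loop-erase p with any? (u ≟_) (verts G q)
  ... | yes u∈ with q′ , r′ ← suffix q (isPath′ r) u∈ = q′ , record
    { isPath′ = isPath′ r′ ; verts⊆ = there ∘ verts⊆ r ∘ verts⊆ r′ ; edges⊆ = there ∘ edges⊆ r ∘ edges⊆ r′ }
  ... | no u∉ = step e J q , record
    { isPath′ = ¬Any⇒All¬ _ u∉ ∷ isPath′ r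
    ; verts⊆  = λ { (here eq) → here eq ; (there m) → there (verts⊆ r m) }
    ; edges⊆  = λ { (here eq) → here eq ; (there m) → there (edges⊆ r m) } }

  edges-nonempty : ∀ {u w} (p : Walk G u w) → u ≢ w → ∃[ e ] e ∈ edges G p
  edges-nonempty []           u≢w = contradiction refl u≢w
  edges-nonempty (step e _ _) _   = e , here refl

  -- Terminals on walks, and construction of T-paths.

  module TPaths {k : ℕ} (τ : Fin k → Fin n) (τ-inj : Injective _≡_ _≡_ τ) where

    T : Fin n → Set
    T = InT G τ

    T? : ∀ v → Dec (T v)
    T? v = Finₚ.any? (λ i → τ i ≟ v)

    ends≢ : ∀ (P : TPath G τ) → τ (src P) ≢ τ (tgt P)
    ends≢ P eq = distinct P (τ-inj eq)

    -- Distinct ends force at least one edge. Hence decoded paths with disjoint edge sets are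
    -- different paths, as feasibility demands.
    samePath-edge : ∀ P Q → SamePath G τ P Q → ∃[ e ] (e ∈ edges G (walk P) × e ∈ edges G (walk Q))
    samePath-edge P Q same with e , e∈ ← edges-nonempty (walk P) (ends≢ P) with same
    ... | inj₁ (_ , eq) = e , e∈ , subst (e ∈_) eq e∈
    ... | inj₂ (_ , eq) = e , e∈ , reverse⁻ (subst (e ∈_) eq e∈)

    Interior : ∀ {u w} → Walk G u w → Set
    Interior {u} {w} p = ∀ x → x ∈ verts G p → T x → x ≡ u ⊎ x ≡ w

    -- The form of `Interior` that survives induction: once a T-path has left its source, the only
    -- terminal ahead is its target.
    Free : ∀ {u w} → Walk G u w → Set
    Free {w = w} p = ∀ x → x ∈ verts G p → T x → x ≡ w

    interior-tail : ∀ {u v w e} {J : Joins G e u v} {p : Walk G v w} →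
      IsPath G (step e J p) → Interior (step e J p) → Free p
    interior-tail (u∉ ∷ _) int x x∈ Tx with int x (there x∈) Tx
    ... | inj₁ refl = contradiction x∈ (All¬⇒¬Any u∉)
    ... | inj₂ eq   = eq

    -- A terminal `u` would have to be the target, which occurs again in the rest of the path.
    free-source : ∀ {u v w e} {J : Joins G e u v} {p : Walk G v w} →
      IsPath G (step e J p) → Free (step e J p) → ¬ T u
    free-source {p = p} (u∉ ∷ _) free Tu with refl ← free _ (here refl) Tu = All¬⇒¬Any u∉ (target∈ p)

    free-tail : ∀ {u v w e} {J : Joins G e u v} {p : Walk G v w} → Free (step e J p) → Free p
    free-tail free x x∈ = free x (there x∈)

    free-edge : ∀ {u w e} (p : Walk G u w) → IsPath G p → Free p → e ∈ edges G p → ∃[ x ] (Inc e x × ¬ T x)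
    free-edge (step _ J p) uq       free (here refl) = _ , joins-incˡ J , free-source {J = J} {p} uq free
    free-edge (step _ J p) (_ ∷ uq) free (there m)   = free-edge p uq (free-tail {J = J} {p} free) m

    -- On a T-path with at least two edges, every edge touches an inner vertex, and inner vertices
    -- lie outside `T`.
    edge-shape : ∀ {u w e} (p : Walk G u w) → IsPath G p → Interior p → e ∈ edges G p →
      (∃[ x ] (Inc e x × ¬ T x)) ⊎
      (verts G p ≡ u ∷ w ∷ [] × edges G p ≡ e ∷ [] × Joins G e u w)
    edge-shape (step _ J []) _ _ (here refl) = inj₂ (refl , refl , J)
    edge-shape (step _ J p@(step _ K q)) uq int (here refl) = inj₁
      (_ , joins-incʳ J , free-source {J = K} {q} (AllPairs.tail uq) (interior-tail {J = J} {p} uq int))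
    edge-shape (step _ J p) uq int (there m) =
      inj₁ (free-edge p (AllPairs.tail uq) (interior-tail {J = J} {p} uq int) m)

    -- In the edge case a chain of distinct edges may pass through a vertex several times, so the
    -- walk read off from it has to be loop-erased first.
    mkTPath : ∀ i j → i ≢ j → (p : Walk G (τ i) (τ j)) → Interior p → TPath G τ
    mkTPath i j i≢j p int = record
      { src = i ; tgt = j ; distinct = i≢j ; walk = proj₁ (loop-erase p) ; isPath = isPath′ (proj₂ (loop-erase p))
      ; onlyEnds = λ x x∈ → int x (verts⊆ (proj₂ (loop-erase p)) x∈) }

    -- Carrying the jump property over to T-paths.

    module Transfer {A : Set} {_≟A_ : DecidableEquality A} {R : Fin k ⊎ A → Fin k ⊎ A → Set}
      {R-sym : Symmetric R} {R-terminals : ∀ {i j} → ¬ R (inj₁ i) (inj₁ j)}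
      (D : TPath G τ → TPath G τ → Set) where
      open Exchange _≟A_ R R-sym R-terminals
      private module P = Path

      -- Feasibility speaks of ends and disjointness only, so the two translations are asked to
      -- respect these rather than to be mutually inverse.
      module _ (encode : TPath G τ → Path) (decode : Path → TPath G τ)
        (src-encode : ∀ P → P.src (encode P) ≡ src P) (tgt-encode : ∀ P → P.tgt (encode P) ≡ tgt P)
        (src-decode : ∀ p → src (decode p) ≡ P.src p) (tgt-decode : ∀ p → tgt (decode p) ≡ P.tgt p)
        (encode-disj : ∀ P Q → ¬ SamePath G τ P Q × D P Q → Disj (encode P) (encode Q))
        (decode-disj : ∀ p q → Disj p q → ¬ SamePath G τ (decode p) (decode q) × D (decode p) (decode q)) where

        encode-count : ∀ ps t → endCount G τ ps t ≡ count (map encode ps) t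
        encode-count []       t = refl
        encode-count (P ∷ ps) t rewrite src-encode P | tgt-encode P | encode-count ps t =
          sym (+-assoc (δ (src P) t) _ _)

        decode-count : ∀ S t → count S t ≡ endCount G τ (map decode S) t
        decode-count []      t = refl
        decode-count (p ∷ S) t rewrite src-decode p | tgt-decode p | decode-count S t =
          +-assoc (δ (P.src p) t) _ _

        encodeJ : ∀ {z} → Feasible G τ D z → Realizable z
        encodeJ (ps , d , eq) = map encode ps , AllPairsₚ.map⁺ (AllPairs.map (λ {P} {Q} → encode-disj P Q) d) ,
          λ t → trans (eq t) (cong pos (encode-count ps t))

        decodeJ : ∀ {z} → Realizable z → Feasible G τ D z
        decodeJ (S , d , eq) = map decode S , AllPairsₚ.map⁺ (AllPairs.map (λ {p} {q} → decode-disj p q) d) ,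
          λ t → trans (eq t) (cong pos (decode-count S t))

        feasible-jump : IsJumpSystem (Feasible G τ D)
        feasible-jump x y Jx Jy x′ st with realizable-jump x y (encodeJ Jx) (encodeJ Jy) x′ st
        ... | inj₁ r            = inj₁ (decodeJ r)
        ... | inj₂ (x″ , s , r) = inj₂ (x″ , s , decodeJ r)

    -- The edge-disjoint case.

    EdgeAdj : Fin k ⊎ Fin m → Fin k ⊎ Fin m → Set
    EdgeAdj (inj₁ _) (inj₁ _) = ⊥
    EdgeAdj (inj₁ i) (inj₂ e) = Inc e (τ i)
    EdgeAdj (inj₂ e) (inj₁ i) = Inc e (τ i)
    -- As in a line graph, but with meetings at terminals ignored, so that a chain never passes
    -- through a terminal.
    EdgeAdj (inj₂ e) (inj₂ f) = ∃[ v ] (¬ T v × Inc e v × Inc f v)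

    EdgeAdj-sym : Symmetric EdgeAdj
    EdgeAdj-sym {inj₁ _} {inj₂ _} r = r
    EdgeAdj-sym {inj₂ _} {inj₁ _} r = r
    EdgeAdj-sym {inj₂ _} {inj₂ _} (v , ¬Tv , i , j) = v , ¬Tv , j , i

    module EdgeCase where
      open Exchange _≟_ EdgeAdj EdgeAdj-sym (λ ())
      private module P = Path

      free-chain : ∀ {e v w j} (p : Walk G v w) → w ≡ τ j → Inc e v → IsPath G p → Free p →
        Chain (inj₂ e) (edges G p) (inj₁ j)
      free-chain []           refl i _  _    = end i
      free-chain (step f J p) eq   i uq free =
        (_ , free-source {J = J} {p} uq free , i , joins-incˡ J) ∷
        free-chain p eq (joins-incʳ J) (AllPairs.tail uq) (free-tail {J = J} {p} free)

      interior-chain : ∀ {u w i j} (p : Walk G u w) → u ≡ τ i → w ≡ τ j → u ≢ w → IsPath G p → Interior p →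
        Chain (inj₁ i) (edges G p) (inj₁ j)
      interior-chain []           _    _  u≢w _  _   = contradiction refl u≢w
      interior-chain (step e J p) refl eq _   uq int =
        joins-incˡ J ∷ free-chain p eq (joins-incʳ J) (AllPairs.tail uq) (interior-tail {J = J} {p} uq int)

      encode : TPath G τ → Path
      encode P = record
        { src = src P ; tgt = tgt P ; inner = edges G (walk P) ; distinct = distinct P
        ; chain = interior-chain (walk P) refl refl (ends≢ P) (isPath P) (onlyEnds P)
        ; unique = edges-unique (walk P) (isPath P) }

      -- The walk stands at an end `u` of `e`. If the chain leaves `e` at the same vertex `u`, as
      -- when three consecutive edges meet there, `e` is skipped; otherwise it is traversed.
      chain-walk : ∀ {e u l j} → Chain (inj₂ e) l (inj₁ j) → Inc e u → ∃ λ (p : Walk G u (τ j)) →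
        (∀ x → x ∈ verts G p → T x → x ≡ u ⊎ x ≡ τ j) × (∀ f → f ∈ edges G p → f ∈ e ∷ l)
      chain-walk {e} {u} {j = j} (end i′) i with u ≟ τ j
      ... | yes refl = [] , (λ { _ (here eq) _ → inj₁ eq }) , λ _ ()
      ... | no u≢    = step e (inc-joins i i′ u≢) [] ,
        (λ { _ (here eq) _ → inj₁ eq ; _ (there (here eq)) _ → inj₂ eq }) ,
        λ { _ (here eq) → here eq }
      chain-walk {e} {u} ((v , ¬Tv , i′ , i″) ∷ c) i with p , vs , es ← chain-walk c i″ | u ≟ v
      ... | yes refl = p , vs , λ f m → there (es f m)
      ... | no u≢    = step e (inc-joins i i′ u≢) p ,
        (λ { _ (here eq) _ → inj₁ eq
           ; x (there m) Tx → [ (λ { refl → contradiction Tx ¬Tv }) , inj₂ ]′ (vs x m Tx) }) ,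
        λ { _ (here eq) → here eq ; f (there m) → there (es f m) }

      path-walk : ∀ {i j l} → Chain (inj₁ i) l (inj₁ j) → ∃ λ (p : Walk G (τ i) (τ j)) →
        Interior p × (∀ f → f ∈ edges G p → f ∈ l)
      path-walk (i ∷ c) = chain-walk c i

      decode : Path → TPath G τ
      decode p = mkTPath (P.src p) (P.tgt p) (P.distinct p) (proj₁ w) (proj₁ (proj₂ w))
        where w = path-walk (P.chain p)

      decode-edges : ∀ p {f} → f ∈ edges G (walk (decode p)) → f ∈ P.inner p
      decode-edges p f∈ with q , _ , es ← path-walk (P.chain p) = es _ (edges⊆ (proj₂ (loop-erase q)) f∈)

      edge-jump : IsJumpSystem (Jedge G τ)
      edge-jump = Transfer.feasible-jump (EdgeDisjoint G τ) encode decode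
        (λ _ → refl) (λ _ → refl) (λ _ → refl) (λ _ → refl) (λ _ _ → proj₂)
        λ p q d → let ed = λ e m m′ → d e (decode-edges p m) (decode-edges q m′) in
          (λ same → let e , m , m′ = samePath-edge (decode p) (decode q) same in ed e m m′) , ed

    -- The openly disjoint case.

    VertexAdj : Fin k ⊎ (Fin m ⊎ Fin n) → Fin k ⊎ (Fin m ⊎ Fin n) → Set
    -- Edges are nodes as well, so that a T-path of a single edge has a nonempty interior. Disjoint
    -- interiors then express both open disjointness and the paths being different.
    VertexAdj (inj₁ i)        (inj₂ (inj₁ e)) = Inc e (τ i)
    VertexAdj (inj₂ (inj₁ e)) (inj₁ i)        = Inc e (τ i)
    VertexAdj (inj₂ (inj₁ e)) (inj₂ (inj₂ v)) = ¬ T v × Inc e v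
    VertexAdj (inj₂ (inj₂ v)) (inj₂ (inj₁ e)) = ¬ T v × Inc e v
    VertexAdj _               _               = ⊥

    VertexAdj-sym : Symmetric VertexAdj
    VertexAdj-sym {inj₁ _}        {inj₂ (inj₁ _)} r = r
    VertexAdj-sym {inj₂ (inj₁ _)} {inj₁ _}        r = r
    VertexAdj-sym {inj₂ (inj₁ _)} {inj₂ (inj₂ _)} r = r
    VertexAdj-sym {inj₂ (inj₂ _)} {inj₂ (inj₁ _)} r = r

    module VertexCase where
      open Exchange (⊎-≡-dec _≟_ _≟_) VertexAdj VertexAdj-sym (λ ())
      private module P = Path

      trace : ∀ {v w} → Walk G v w → List (Fin m ⊎ Fin n)
      trace []               = []
      trace {v} (step f _ p) = inj₂ v ∷ inj₁ f ∷ trace p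

      interior : ∀ {v w} → Walk G v w → List (Fin m ⊎ Fin n)
      interior []           = []
      interior (step e _ p) = inj₁ e ∷ trace p

      trace-vert : ∀ {v w x} (p : Walk G v w) → IsPath G p → Free p → inj₂ x ∈ trace p → x ∈ verts G p × ¬ T x
      trace-vert (step f J p) uq free (here refl) = here refl , free-source {J = J} {p} uq free
      trace-vert (step f J p) uq free (there (there m))
        with x∈ , ¬Tx ← trace-vert p (AllPairs.tail uq) (free-tail {J = J} {p} free) m = there x∈ , ¬Tx

      trace-edge : ∀ {v w e} (p : Walk G v w) → inj₁ e ∈ trace p → e ∈ edges G p
      trace-edge (step f J p) (there (here refl)) = here refl
      trace-edge (step f J p) (there (there m))   = there (trace-edge p m)

      interior-vert : ∀ {u w x} (p : Walk G u w) → IsPath G p → Interior p → inj₂ x ∈ interior p →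
        x ∈ verts G p × ¬ T x
      interior-vert (step e J p) uq int (there m)
        with x∈ , ¬Tx ← trace-vert p (AllPairs.tail uq) (interior-tail {J = J} {p} uq int) m = there x∈ , ¬Tx

      interior-edge : ∀ {u w e} (p : Walk G u w) → inj₁ e ∈ interior p → e ∈ edges G p
      interior-edge (step e J p) (here refl) = here refl
      interior-edge (step e J p) (there m)   = there (trace-edge p m)

      trace-unique : ∀ {v w} (p : Walk G v w) → IsPath G p → Free p → Unique (trace p)
      trace-unique []           _  _    = []
      trace-unique (step f J p) (v∉ ∷ uq) free =
        ¬Any⇒All¬ _ (λ { (there m) → All¬⇒¬Any v∉ (proj₁ (trace-vert p uq free′ m)) }) ∷
        ¬Any⇒All¬ _ (λ m → Unique[x∷xs]⇒x∉xs (edges-unique (step f J p) (v∉ ∷ uq)) (trace-edge p m)) ∷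
        trace-unique p uq free′
        where free′ = free-tail {J = J} {p} free

      interior-unique : ∀ {u w} (p : Walk G u w) → IsPath G p → Interior p → Unique (interior p)
      interior-unique []           _  _   = []
      interior-unique (step e J p) uq int =
        ¬Any⇒All¬ _ (λ m → Unique[x∷xs]⇒x∉xs (edges-unique (step e J p) uq) (trace-edge p m)) ∷
        trace-unique p (AllPairs.tail uq) (interior-tail {J = J} {p} uq int)

      free-chain : ∀ {e v w j} (p : Walk G v w) → w ≡ τ j → Inc e v → IsPath G p → Free p →
        Chain (inj₂ (inj₁ e)) (trace p) (inj₁ j)
      free-chain []           refl i _  _    = end i
      free-chain (step f J p) eq   i uq free = (¬Tv , i) ∷ (¬Tv , joins-incˡ J) ∷
        free-chain p eq (joins-incʳ J) (AllPairs.tail uq) (free-tail {J = J} {p} free)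
        where ¬Tv = free-source {J = J} {p} uq free

      interior-chain : ∀ {u w i j} (p : Walk G u w) → u ≡ τ i → w ≡ τ j → u ≢ w → IsPath G p → Interior p →
        Chain (inj₁ i) (interior p) (inj₁ j)
      interior-chain []           _    _  u≢w _  _   = contradiction refl u≢w
      interior-chain (step e J p) refl eq _   uq int =
        joins-incˡ J ∷ free-chain p eq (joins-incʳ J) (AllPairs.tail uq) (interior-tail {J = J} {p} uq int)

      encode : TPath G τ → Path
      encode P = record
        { src = src P ; tgt = tgt P ; inner = interior (walk P) ; distinct = distinct P
        ; chain = interior-chain (walk P) refl refl (ends≢ P) (isPath P) (onlyEnds P)
        ; unique = interior-unique (walk P) (isPath P) (onlyEnds P) }

      -- The chain alternates between edges and vertices, so it is consumed two nodes at a time.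
      -- Every vertex of the walk apart from its ends is traced to a node of the chain, which later
      -- yields open disjointness.
      chain-walk : ∀ {e u l j} → Chain (inj₂ (inj₁ e)) l (inj₁ j) → Inc e u → ∃ λ (p : Walk G u (τ j)) →
        (∀ x → x ∈ verts G p → (x ≡ u ⊎ x ≡ τ j) ⊎ (¬ T x × inj₂ x ∈ l)) ×
        (∀ f → f ∈ edges G p → inj₁ f ∈ inj₁ e ∷ l)
      chain-walk {e} {u} {j = j} (end i′) i with u ≟ τ j
      ... | yes refl = [] , (λ { _ (here eq) → inj₁ (inj₁ eq) }) , λ _ ()
      ... | no u≢    = step e (inc-joins i i′ u≢) [] ,
        (λ { _ (here eq) → inj₁ (inj₁ eq) ; _ (there (here eq)) → inj₁ (inj₂ eq) }) ,
        λ { _ (here refl) → here refl }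
      chain-walk {e} {u} (_∷_ {a = inj₂ v} (¬Tv , i′) (_∷_ {a = inj₁ f} (_ , i″) c)) i
        with p , vs , es ← chain-walk c i″ | u ≟ v
      ... | yes refl = p ,
        (λ x m → [ inj₁ , (λ (¬Tx , x∈) → inj₂ (¬Tx , there (there x∈))) ]′ (vs x m)) ,
        λ f m → there (there (es f m))
      ... | no u≢    = step e (inc-joins i i′ u≢) p ,
        (λ { _ (here eq) → inj₁ (inj₁ eq)
           ; x (there m) → [ [ (λ { refl → inj₂ (¬Tv , here refl) }) , inj₁ ∘ inj₂ ]′ ,
               (λ (¬Tx , x∈) → inj₂ (¬Tx , there (there x∈))) ]′ (vs x m) }) ,
        λ { _ (here refl) → here refl ; f (there m) → there (there (es f m)) }

      path-walk : ∀ {i j l} → Chain (inj₁ i) l (inj₁ j) → ∃ λ (p : Walk G (τ i) (τ j)) →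
        Interior p × (∀ x → x ∈ verts G p → ¬ T x → inj₂ x ∈ l) × (∀ f → f ∈ edges G p → inj₁ f ∈ l)
      path-walk {i} {j} (_∷_ {a = inj₁ e} inc c) with p , vs , es ← chain-walk c inc = p ,
        (λ x m Tx → [ (λ eq → eq) , (λ (¬Tx , _) → contradiction Tx ¬Tx) ]′ (vs x m)) ,
        (λ x m ¬Tx → [ [ (λ eq → contradiction (i , sym eq) ¬Tx) , (λ eq → contradiction (j , sym eq) ¬Tx) ]′ ,
          there ∘ proj₂ ]′ (vs x m)) , es

      decode : Path → TPath G τ
      decode p = mkTPath (P.src p) (P.tgt p) (P.distinct p) (proj₁ w) (proj₁ (proj₂ w))
        where w = path-walk (P.chain p)

      decode-verts : ∀ p {x} → x ∈ verts G (walk (decode p)) → ¬ T x → inj₂ x ∈ P.inner p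
      decode-verts p x∈ ¬Tx with q , _ , vs , _ ← path-walk (P.chain p) =
        vs _ (verts⊆ (proj₂ (loop-erase q)) x∈) ¬Tx

      decode-edges : ∀ p {f} → f ∈ edges G (walk (decode p)) → inj₁ f ∈ P.inner p
      decode-edges p f∈ with q , _ , _ , es ← path-walk (P.chain p) = es _ (edges⊆ (proj₂ (loop-erase q)) f∈)

      -- Openly disjoint T-paths can only share an edge joining two terminals, and then both consist of that edge.
      shared-edge : ∀ P Q {e} → OpenlyDisjoint G τ P Q → e ∈ edges G (walk P) → e ∈ edges G (walk Q) → SamePath G τ P Q
      shared-edge P Q od m m′
        with edge-shape (walk P) (isPath P) (onlyEnds P) m | edge-shape (walk Q) (isPath Q) (onlyEnds Q) m′
      ... | inj₁ (x , i , ¬Tx) | _ = contradiction (od x (edge-end∈ (walk P) m i) (edge-end∈ (walk Q) m′ i)) ¬Tx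
      ... | inj₂ _ | inj₁ (x , i , ¬Tx) = contradiction (od x (edge-end∈ (walk P) m i) (edge-end∈ (walk Q) m′ i)) ¬Tx
      ... | inj₂ (vP , eP , JP) | inj₂ (vQ , eQ , JQ) = same JP JQ
        where
        pair : ∀ {a b c d : Fin n} → (a , b) ≡ (c , d) → a ∷ b ∷ [] ≡ c ∷ d ∷ []
        pair refl = refl
        pairʳ : ∀ {a b c d : Fin n} → (a , b) ≡ (d , c) → a ∷ b ∷ [] ≡ reverse (c ∷ d ∷ [])
        pairʳ refl = refl
        parallel : (τ (src P) , τ (tgt P)) ≡ (τ (src Q) , τ (tgt Q)) → SamePath G τ P Q
        parallel eq = inj₁ (trans vP (trans (pair eq) (sym vQ)) , trans eP (sym eQ))
        opposite : (τ (src P) , τ (tgt P)) ≡ (τ (tgt Q) , τ (src Q)) → SamePath G τ P Q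
        opposite eq = inj₂ (trans vP (trans (pairʳ eq) (sym (cong reverse vQ))) , trans eP (sym (cong reverse eQ)))
        same : Joins G _ (τ (src P)) (τ (tgt P)) → Joins G _ (τ (src Q)) (τ (tgt Q)) → SamePath G τ P Q
        same (inj₁ p) (inj₁ q) = parallel (trans (sym p) q)
        same (inj₁ p) (inj₂ q) = opposite (trans (sym p) q)
        same (inj₂ p) (inj₁ q) = opposite (cong ×-swap (trans (sym p) q))
        same (inj₂ p) (inj₂ q) = parallel (cong ×-swap (trans (sym p) q))

      -- A shared edge would make the two paths equal; a shared vertex node lies outside `T`,
      -- against open disjointness.
      encode-disj : ∀ P Q → ¬ SamePath G τ P Q × OpenlyDisjoint G τ P Q → Disj (encode P) (encode Q)
      encode-disj P Q (¬same , od) (inj₁ e) m m′ =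
        ¬same (shared-edge P Q od (interior-edge (walk P) m) (interior-edge (walk Q) m′))
      encode-disj P Q (¬same , od) (inj₂ x) m m′
        with x∈ , ¬Tx ← interior-vert (walk P) (isPath P) (onlyEnds P) m =
        ¬Tx (od x x∈ (proj₁ (interior-vert (walk Q) (isPath Q) (onlyEnds Q) m′)))

      decode-disj : ∀ p q → Disj p q →
        ¬ SamePath G τ (decode p) (decode q) × OpenlyDisjoint G τ (decode p) (decode q)
      decode-disj p q d =
        (λ same → let e , m , m′ = samePath-edge (decode p) (decode q) same
                  in d (inj₁ e) (decode-edges p m) (decode-edges q m′)) ,
        -- Disjoint interiors only refute that `x` lies outside `T`; decidability of `T` turns this
        -- into membership.
        λ x m m′ → decidable-stable (T? x) λ ¬Tx → d (inj₂ x) (decode-verts p m ¬Tx) (decode-verts q m′ ¬Tx)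

      vertex-jump : IsJumpSystem (Jvertex G τ)
      vertex-jump = Transfer.feasible-jump (OpenlyDisjoint G τ) encode decode
        (λ _ → refl) (λ _ → refl) (λ _ → refl) (λ _ → refl) encode-disj decode-disj

theorem1 : ∀ {n k : ℕ} (G : Graph n) (τ : Fin k → Fin n) → Injective _≡_ _≡_ τ →
    IsJumpSystem (Jvertex G τ) × IsJumpSystem (Jedge G τ)
theorem1 G τ τ-inj = VertexCase.vertex-jump , EdgeCase.edge-jump
  where open TPaths G τ τ-inj
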